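{- Let $\lambda$ be a regular uncountable cardinal and let $\kappa$ be a cardinal with $2\le\kappa<\lambda$. Assume that $\otimes^\kappa_\lambda$ holds, or just that $\oplus^\kappa_\lambda$ holds (both defined in the context). Then there is a symmetric two-place function $c$ from $\lambda$ to $\aleph_0$ such that: whenever $\langle w_i:i<\lambda\rangle$ is a sequence of pairwise disjoint non-empty subsets of $\lambda$ with $|w_i|<\kappa$ for all $i<\lambda$, and $n<\omega$, there is $Y\in[\lambda]^\lambda$ such that for all $i<j$ from $Y$: every element of $w_i$ is smaller than every element of $w_j$, and $c(\alpha,\beta)>n$ for all $\alpha\in w_i$ and $\beta\in w_j$.
   Context: $[\lambda]^\lambda$ is the family of subsets of $\lambda$ of cardinality $\lambda$. For a set $C$ of ordinals, $\mathrm{acc}(C)=\{\alpha\in C:\alpha=\sup(\alpha\cap C)\}$ and $\mathrm{nacc}(C)=C\setminus\mathrm{acc}(C)$. "Inaccessible" means weakly inaccessible (uncountable regular limit cardinal); $\lambda$ is Mahlo if it is inaccessible and the set of inaccessibles below $\lambda$ is stationary in $\lambda$. Put $S^\lambda_{\mathrm{in}}=\{\delta<\lambda:\delta\text{ is inaccessible}\}$ and $S^\lambda_{\ge\kappa}=\{\delta<\lambda:\mathrm{cf}(\delta)\ge\kappa\}$. $\otimes^\kappa_\lambda$ (for $\lambda$ Mahlo, $\kappa<\lambda$): there is $\bar C=\langle C_\delta:\delta\in S^\lambda_{\mathrm{in}}\rangle$ with each $C_\delta$ a club of $\delta$, such that for every club $E$ of $\lambda$ there is $\delta\in\mathrm{acc}(E)\cap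 S^\lambda_{\mathrm{in}}$ with $\mathrm{cf}(\delta)\ge\kappa$ such that for no $\zeta<\kappa$ and $\alpha_\varepsilon\in S^\lambda_{\mathrm{in}}$ ($\varepsilon<\zeta$) is $(\mathrm{nacc}(E)\cap\delta)\setminus\bigcup_{\varepsilon<\zeta}C_{\alpha_\varepsilon}$ bounded in $\delta$. $\oplus^\kappa_\lambda$ (for $\lambda$ regular uncountable, $\kappa<\lambda$): there is $\bar C=\langle C_\delta:\delta\in S\rangle$, where $S=\{\delta<\lambda:\delta\text{ a limit ordinal}\}$ and each $C_\delta$ is a club of $\delta$, such that for every club $E$ of $\lambda$ there is $\delta\in\mathrm{acc}(E)$ with $\mathrm{cf}(\delta)\ge\kappa$ such that for no $\zeta<\kappa$ and $\alpha_\varepsilon\in S$ ($\varepsilon<\zeta$) is $(S^\lambda_{\ge\kappa}\cap E\cap\delta)\setminus\bigcup_{\varepsilon<\zeta}C_{\alpha_\varepsilon}$ bounded in $\delta$. -}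

module Defs where

open import Level using (Level; _⊔_; suc)
open import Data.Nat.Base using (ℕ)
open import Data.Product.Base using (Σ-syntax; ∃-syntax; _×_)
open import Function.Definitions using (Injective)
open import Induction.WellFounded using (WellFounded)
open import Relation.Binary.Core using (Rel)
open import Relation.Binary.PropositionalEquality.Core using (_≡_)
open import Relation.Binary.Structures using (IsStrictTotalOrder)
open import Relation.Nullary.Negation.Core using (¬_)
open import Relation.Unary using (Pred; _∈_; _⊆_; _∩_; _∖_; U; Satisfiable)
import Relation.Binary.Construct.StrictToNonStrict as StrictToNonStrict

record WellOrder ℓ : Set (suc ℓ) where
  infix 4 _<_
  field
    Carrier            : Set ℓ
    _<_                : Rel Carrier ℓ
    isStrictTotalOrder : IsStrictTotalOrder _≡_ _<_
    wellFounded        : WellFounded _<_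

  open StrictToNonStrict _≡_ _<_ public using (_≤_)

-- A well-order Λ stands for the ordinal λ that is its order type, and the
-- elements of Λ for the ordinals below λ.  To treat λ and the ordinals below it
-- uniformly, an ordinal ≤ λ is identified, as with von Neumann ordinals, with
-- the set of its predecessors: ↓ α for α < λ, and U for λ itself.  Where a
-- parameter below is called P, K or M it is meant to be such an initial segment;
-- A, B, C, E are arbitrary subsets.
--
-- A function or sequence defined on a subset is given by a total function, of
-- which only the values on that subset are constrained.

module Ordinals {ℓ : Level} (Λ : WellOrder ℓ) where
  open WellOrder Λ renaming (Carrier to L)

  private variable
    a b p k m : Level

  ↓_ : L → Pred L ℓ
  ↓ α = λ ξ → ξ < α

  ---------------------------------------------------------------------
  -- Cardinality

  Equinumerous : Pred L a → Pred L b → Set (ℓ ⊔ a ⊔ b)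
  Equinumerous A B = Σ[ f ∈ (L → L) ]
      (∀ {x} → x ∈ A → f x ∈ B)
    × (∀ {x y} → x ∈ A → y ∈ A → f x ≡ f y → x ≡ y)
    × (∀ {y} → y ∈ B → ∃[ x ] x ∈ A × f x ≡ y)

  IsCardinal : Pred L p → Set (ℓ ⊔ p)
  IsCardinal P = ∀ α → α ∈ P → ¬ Equinumerous (↓ α) P

  HasCardinality : Pred L a → Pred L m → Set (ℓ ⊔ a ⊔ m)
  HasCardinality A M = IsCardinal M × Equinumerous A M

  CardinalityBelow : Pred L a → L → Set (ℓ ⊔ a)
  CardinalityBelow A κ = ∃[ μ ] μ < κ × HasCardinality A (↓ μ)

  IsInfinite : Pred L a → Set (ℓ ⊔ a)
  IsInfinite A = Σ[ f ∈ (ℕ → L) ] (∀ n → f n ∈ A) × Injective _≡_ _≡_ f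

  IsCountable : Pred L a → Set (ℓ ⊔ a)
  IsCountable A = Σ[ f ∈ (L → ℕ) ]
    (∀ {x y} → x ∈ A → y ∈ A → f x ≡ f y → x ≡ y)

  IsUncountable : Pred L a → Set (ℓ ⊔ a)
  IsUncountable A = ¬ IsCountable A

  -- There are two distinct ordinals below κ.
  AtLeastTwo : L → Set ℓ
  AtLeastTwo κ = ∃[ α ] ∃[ β ] α < β × β < κ

  ---------------------------------------------------------------------
  -- Cofinality, regular and inaccessible cardinals

  CofinalMap : Pred L k → Pred L p → Set (ℓ ⊔ k ⊔ p)
  CofinalMap K P = Σ[ f ∈ (L → L) ]
      (∀ {ξ} → ξ ∈ K → f ξ ∈ P)
    × (∀ {β} → β ∈ P → ∃[ ξ ] ξ ∈ K × β ≤ f ξ)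

  -- cf(P) = K: the least ordinal mapping cofinally into P is K.
  IsCofinality : Pred L p → Pred L k → Set (ℓ ⊔ p ⊔ k)
  IsCofinality P K = CofinalMap K P × (∀ ζ → ζ ∈ K → ¬ CofinalMap (↓ ζ) P)

  -- cf(δ) ≥ κ
  CofinalityAtLeast : L → L → Set ℓ
  CofinalityAtLeast κ δ = ∃[ μ ] IsCofinality (↓ δ) (↓ μ) × κ ≤ μ

  IsRegular : Pred L p → Set (ℓ ⊔ p)
  IsRegular P = IsCardinal P × IsInfinite P × IsCofinality P P

  IsLimitCardinal : Pred L p → Set (ℓ ⊔ p)
  IsLimitCardinal P = IsCardinal P
    × (∀ μ → μ ∈ P → IsCardinal (↓ μ) → ∃[ ν ] ν ∈ P × IsCardinal (↓ ν) × μ < ν)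

  IsInaccessible : Pred L p → Set (ℓ ⊔ p)
  IsInaccessible P = IsUncountable P × IsRegular P × IsLimitCardinal P

  IsLimitOrdinal : L → Set ℓ
  IsLimitOrdinal δ = Satisfiable (↓ δ)
    × (∀ ξ → ξ < δ → ∃[ η ] ξ < η × η < δ)

  ---------------------------------------------------------------------
  -- Clubs and stationary sets

  -- α = sup A
  IsSup : Pred L a → L → Set (ℓ ⊔ a)
  IsSup A α = (∀ ξ → ξ ∈ A → ξ ≤ α) × (∀ β → (∀ ξ → ξ ∈ A → ξ ≤ β) → α ≤ β)

  acc : Pred L a → Pred L (ℓ ⊔ a)
  acc C α = α ∈ C × IsSup (C ∩ ↓ α) α

  nacc : Pred L a → Pred L (ℓ ⊔ a)
  nacc C = C ∖ acc C

  BoundedIn : Pred L p → Pred L a → Set (ℓ ⊔ p ⊔ a)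
  BoundedIn P A = ∃[ β ] β ∈ P × A ⊆ ↓ β

  UnboundedIn : Pred L p → Pred L a → Set (ℓ ⊔ p ⊔ a)
  UnboundedIn P A = ∀ β → β ∈ P → ∃[ ξ ] ξ ∈ A × β ≤ ξ

  -- Nonemptiness of C ∩ ↓ α is needed because sup ∅ = 0.
  ClosedIn : Pred L p → Pred L a → Set (ℓ ⊔ p ⊔ a)
  ClosedIn P C = ∀ α → α ∈ P → Satisfiable (C ∩ ↓ α) → IsSup (C ∩ ↓ α) α → α ∈ C

  IsClubIn : Pred L p → Pred L a → Set (ℓ ⊔ p ⊔ a)
  IsClubIn P C = C ⊆ P × UnboundedIn P C × ClosedIn P C

  IsStationary : Pred L ℓ → Set (suc ℓ)
  IsStationary A = (E : Pred L ℓ) → IsClubIn U E → Satisfiable (A ∩ E)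

  S-in : Pred L ℓ
  S-in δ = IsInaccessible (↓ δ)

  IsMahlo : Set (suc ℓ)
  IsMahlo = IsInaccessible U × IsStationary S-in

  ---------------------------------------------------------------------
  -- The two guessing principles

  S≥ : L → Pred L ℓ
  S≥ κ = CofinalityAtLeast κ

  -- The union of the sets C (α ε) over ε < ζ.
  ⋃[_] : L → (L → Pred L ℓ) → (L → L) → Pred L ℓ
  ⋃[ ζ ] C α ξ = ∃[ ε ] ε < ζ × ξ ∈ C (α ε)

  Otimes : L → Set (suc ℓ)
  Otimes κ = IsMahlo ×
    (Σ[ C ∈ (L → Pred L ℓ) ]
      (∀ δ → δ ∈ S-in → IsClubIn (↓ δ) (C δ))
    × (∀ (E : Pred L ℓ) → IsClubIn U E →
        ∃[ δ ] δ ∈ acc E × δ ∈ S-in × CofinalityAtLeast κ δ ×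
          (∀ ζ → ζ < κ → (α : L → L) → (∀ ε → ε < ζ → α ε ∈ S-in) →
            ¬ BoundedIn (↓ δ) ((nacc E ∩ ↓ δ) ∖ ⋃[ ζ ] C α))))

  Oplus : L → Set (suc ℓ)
  Oplus κ =
    Σ[ C ∈ (L → Pred L ℓ) ]
      (∀ δ → δ ∈ IsLimitOrdinal → IsClubIn (↓ δ) (C δ))
    × (∀ (E : Pred L ℓ) → IsClubIn U E →
        ∃[ δ ] δ ∈ acc E × CofinalityAtLeast κ δ ×
          (∀ ζ → ζ < κ → (α : L → L) → (∀ ε → ε < ζ → α ε ∈ IsLimitOrdinal) →
            ¬ BoundedIn (↓ δ) ((S≥ κ ∩ E ∩ ↓ δ) ∖ ⋃[ ζ ] C α)))

{-# OPTIONS --safe #-}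

-- c(α,β) is the length of the walk from the larger of α and β down to the
-- smaller, along a ladder system C.  Suppose w is a family of fewer than κ
-- ordinals above δ, with cf(δ) ≥ κ.  For α < δ close enough to δ the walk from
-- β ∈ w to α runs through the first ordinal τ_β ≥ δ on the walk from β to δ such
-- that C(τ_β) is unbounded in δ.  If γ < δ lies outside all the C(τ_β) and
-- cf(γ) ≥ κ, then for α < γ close enough to γ the next step from τ_β leads to an
-- ordinal β' ≥ γ that does not depend on α.  So, below γ, walks to w are longer
-- than walks to the small family of all β', and the guessing principle makes
-- this happen for γ in any prescribed club.  Iterating n times yields walks
-- longer than n.
--
-- Under ⊗ the ladders at non-inaccessible ordinals are chosen without inaccessible
-- limit points, so that τ_β is inaccessible whenever δ is, and ⊗ is applied to the
-- closure of E ∩ S≥κ, whose non-accumulation points lie in E ∩ S≥κ.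

module Submission where

open import Level using (Level; Lift; lift; lower; suc)
open import Axiom.ExcludedMiddle using (ExcludedMiddle)
open import Data.Empty using (⊥-elim)
open import Data.Nat.Base using (ℕ; z≤n; s≤s) renaming (_<_ to _<ℕ_; _≤_ to _≤ℕ_; _+_ to _+ℕ_)
import Data.Nat.Base as ℕ
import Data.Nat.Properties as ℕ
open import Data.Product.Base using (Σ-syntax; ∃-syntax; _×_; _,_; proj₁; proj₂)
open import Data.Sum.Base using (_⊎_; inj₁; inj₂; [_,_]′)
open import Data.Unit.Base using (⊤; tt)
open import Function.Base using (id; _∘_)
open import Induction.WellFounded using (WfRec; module All; module FixPoint)
open import Relation.Binary.Definitions using (Trans; tri<; tri≈; tri>)
open import Relation.Binary.PropositionalEquality.Core
  using (_≡_; _≢_; refl; sym; trans; cong; subst)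
open import Relation.Binary.Structures using (IsStrictTotalOrder)
open import Relation.Nullary.Decidable.Core using (Dec; yes; no; map′; decidable-stable)
open import Relation.Nullary.Negation.Core using (¬_)
open import Relation.Unary using (Pred; _∈_; _∉_; _⊆_; _⊥_; _∩_; _∖_; U; Satisfiable)
import Relation.Binary.Construct.StrictToNonStrict as StrictToNonStrict
open import Defs

module Classical {ℓ : Level} (em : ExcludedMiddle ℓ) (Λ : WellOrder ℓ) where
  open WellOrder Λ renaming (Carrier to L)
  open Ordinals Λ
  open IsStrictTotalOrder isStrictTotalOrder
    using (compare; _<?_; irrefl; <-respʳ-≈; <-respˡ-≈) renaming (trans to <-trans)

  private variable
    p : Level
    α β γ δ ζ κ : L

  -- Linear order, minima and choice functions.

  by-contradiction : {P : Set ℓ} → ¬ ¬ P → P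
  by-contradiction = decidable-stable em

  <-≤-trans : Trans _<_ _≤_ _<_
  <-≤-trans = StrictToNonStrict.<-≤-trans _≡_ _<_ <-trans <-respʳ-≈

  ≤-<-trans : Trans _≤_ _<_ _<_
  ≤-<-trans = StrictToNonStrict.≤-<-trans _≡_ _<_ sym <-trans <-respˡ-≈

  ≤-trans : Trans _≤_ _≤_ _≤_
  ≤-trans (inj₁ x<y) y≤z = inj₁ (<-≤-trans x<y y≤z)
  ≤-trans (inj₂ refl) y≤z = y≤z

  ≤-refl : α ≤ α
  ≤-refl = inj₂ refl

  <⇒≱ : α < β → ¬ β ≤ α
  <⇒≱ α<β β≤α = irrefl refl (<-≤-trans α<β β≤α)

  ≮⇒≥ : ¬ α < β → β ≤ α
  ≮⇒≥ {α} {β} α≮β with compare α β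
  ... | tri< α<β _ _ = ⊥-elim (α≮β α<β)
  ... | tri≈ _ α≡β _ = inj₂ (sym α≡β)
  ... | tri> _ _ β<α = inj₁ β<α

  ≰⇒> : ¬ α ≤ β → β < α
  ≰⇒> {α} {β} α≰β with compare α β
  ... | tri< α<β _ _ = ⊥-elim (α≰β (inj₁ α<β))
  ... | tri≈ _ α≡β _ = ⊥-elim (α≰β (inj₂ α≡β))
  ... | tri> _ _ β<α = β<α

  ≤-antisym : α ≤ β → β ≤ α → α ≡ β
  ≤-antisym (inj₂ α≡β) _ = α≡β
  ≤-antisym (inj₁ α<β) β≤α = ⊥-elim (<⇒≱ α<β β≤α)

  join : ∀ (A : Pred L p) α β → α ∈ A → β ∈ A → ∃[ γ ] γ ∈ A × α ≤ γ × β ≤ γ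
  join A α β α∈A β∈A with α <? β
  ... | yes α<β = β , β∈A , inj₁ α<β , ≤-refl
  ... | no α≮β = α , α∈A , ≤-refl , ≮⇒≥ α≮β

  <-induction : (P : Pred L ℓ) → (∀ α → (∀ {β} → β < α → P β) → P α) → ∀ α → P α
  <-induction = All.wfRec wellFounded ℓ

  IsLeast : Pred L ℓ → Pred L ℓ
  IsLeast A m = m ∈ A × (∀ α → α ∈ A → m ≤ α)

  least : (A : Pred L ℓ) → Satisfiable A → ∃[ m ] IsLeast A m
  least A (α , α∈A) = by-contradiction λ none →
    <-induction (λ β → β ∉ A)
      (λ β below∉A β∈A → none (β , β∈A , λ γ γ∈A → ≮⇒≥ λ γ<β → below∉A γ<β γ∈A))
      α α∈A

  IsLeast-unique : {A : Pred L ℓ} → IsLeast A α → IsLeast A β → α ≡ β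
  IsLeast-unique (α∈A , α≤) (β∈A , β≤) = ≤-antisym (α≤ _ β∈A) (β≤ _ α∈A)

  choose : ∀ {r} {A : Pred L ℓ} {R : L → L → Set r} →
    (∀ ξ → ξ ∈ A → ∃[ η ] R ξ η) → Σ[ f ∈ (L → L) ] ∀ ξ → ξ ∈ A → R ξ (f ξ)
  choose {A = A} {R} total = (λ ξ → value ξ em) , λ ξ → value-correct ξ em
    where
    value : ∀ ξ → Dec (ξ ∈ A) → L
    value ξ (yes ξ∈A) = proj₁ (total ξ ξ∈A)
    value ξ (no _)    = ξ

    value-correct : ∀ ξ (d : Dec (ξ ∈ A)) → ξ ∈ A → R ξ (value ξ d)
    value-correct ξ (yes ξ∈A) _ = proj₂ (total ξ ξ∈A)
    value-correct ξ (no ξ∉A) ξ∈A = ⊥-elim (ξ∉A ξ∈A)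

  -- The least x is taken because a choice of x that is insensitive to the
  -- representation of the earlier values is needed to unfold the recursion.
  dependent-choice : (V : Pred L ℓ) (R : L → L → Set ℓ) →
    (∀ ξ (y : L → L) → (∀ η → η < ξ → y η ∈ V) → ∃[ x ] x ∈ V × (∀ η → η < ξ → R (y η) x)) →
    Σ[ g ∈ (L → L) ] ∀ ξ → g ξ ∈ V × (∀ η → η < ξ → R (g η) (g ξ))
  dependent-choice V R extend = g , g-correct
    where
    Admissible : ∀ ξ → WfRec _<_ (λ _ → L) ξ → Pred L ℓ
    Admissible ξ y x = x ∈ V × (∀ η (η<ξ : η < ξ) → R (y η<ξ) x)

    step′ : ∀ ξ (y : WfRec _<_ (λ _ → L) ξ) → Dec (Satisfiable (Admissible ξ y)) → L
    step′ ξ y (yes s) = proj₁ (least _ s)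
    step′ ξ y (no _)  = ξ

    step : ∀ ξ → WfRec _<_ (λ _ → L) ξ → L
    step ξ y = step′ ξ y em

    Admissible-cong : ∀ ξ {y z : WfRec _<_ (λ _ → L) ξ} →
      (∀ {η} η<ξ → y {η} η<ξ ≡ z η<ξ) → Admissible ξ y ⊆ Admissible ξ z
    Admissible-cong ξ y≡z (x∈V , related) =
      x∈V , λ η η<ξ → subst (λ v → R v _) (y≡z η<ξ) (related η η<ξ)

    step′-cong : ∀ ξ {y z : WfRec _<_ (λ _ → L) ξ} (d : Dec _) (e : Dec _) →
      (∀ {η} η<ξ → y {η} η<ξ ≡ z η<ξ) → step′ ξ y d ≡ step′ ξ z e
    step′-cong ξ {y} {z} (yes s) (yes t) y≡z =
      let (m∈ , m≤) = proj₂ (least _ s) in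
      IsLeast-unique
        (Admissible-cong ξ y≡z m∈ ,
          λ x x∈ → m≤ x (Admissible-cong ξ (λ η<ξ → sym (y≡z η<ξ)) x∈))
        (proj₂ (least (Admissible ξ z) t))
    step′-cong ξ (yes (x , x∈)) (no none) y≡z = ⊥-elim (none (x , Admissible-cong ξ y≡z x∈))
    step′-cong ξ (no none) (yes (x , x∈)) y≡z =
      ⊥-elim (none (x , Admissible-cong ξ (λ η<ξ → sym (y≡z η<ξ)) x∈))
    step′-cong ξ (no _) (no _) y≡z = refl

    g : L → L
    g = All.wfRec wellFounded ℓ (λ _ → L) step

    g-unfold : ∀ ξ → g ξ ≡ step ξ (λ {η} _ → g η)
    g-unfold ξ = FixPoint.unfold-wfRec wellFounded (λ _ → L) step
      (λ ξ y≡z → step′-cong ξ em em y≡z)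

    Correct : Pred L ℓ
    Correct ξ = g ξ ∈ V × (∀ η → η < ξ → R (g η) (g ξ))

    step′-correct : ∀ ξ (d : Dec _) → (∀ {η} → η < ξ → Correct η) →
      step′ ξ (λ {η} _ → g η) d ∈ Admissible ξ (λ {η} _ → g η)
    step′-correct ξ (yes s) _ = proj₁ (proj₂ (least _ s))
    step′-correct ξ (no none) ih = ⊥-elim (none (extend ξ g (λ η η<ξ → proj₁ (ih η<ξ))))

    g-correct : ∀ ξ → Correct ξ
    g-correct = <-induction Correct λ ξ ih →
      subst (_∈ Admissible ξ (λ {η} _ → g η)) (sym (g-unfold ξ)) (step′-correct ξ em ih)

  -- Cofinality

  -- `CofinalMap` asks for `β ≤ f ξ`, so its failure gives a strict bound directly. This is how
  -- cofinality enters: fewer than κ thresholds below an ordinal of cofinality at least κ get one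
  -- common bound.
  strict-bound : {P : Pred L ℓ} → ¬ CofinalMap (↓ ζ) P →
    (f : L → L) → (∀ ξ → ξ < ζ → f ξ ∈ P) → ∃[ β ] β ∈ P × (∀ ξ → ξ < ζ → f ξ < β)
  strict-bound ¬cofinal f f∈P = by-contradiction λ unbounded →
    ¬cofinal (f , f∈P _ , λ {β} β∈P → by-contradiction λ β≰f →
      unbounded (β , β∈P , λ ξ ξ<ζ → ≰⇒> λ β≤fξ → β≰f (ξ , ξ<ζ , β≤fξ)))

  cofinalityAtLeast⇒¬cofinalMap : CofinalityAtLeast κ δ → ζ < κ → ¬ CofinalMap (↓ ζ) (↓ δ)
  cofinalityAtLeast⇒¬cofinalMap (_ , (_ , minimal) , κ≤μ) ζ<κ = minimal _ (<-≤-trans ζ<κ κ≤μ)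

  cofinalityAtLeast⇒limit : AtLeastTwo κ → CofinalityAtLeast κ δ → IsLimitOrdinal δ
  cofinalityAtLeast⇒limit (α , β , α<β , β<κ) cf≥κ@(_ , ((f , f∈δ , _) , _) , κ≤μ) =
    (f α , f∈δ (<-trans α<β (<-≤-trans β<κ κ≤μ))) , λ ξ ξ<δ →
      -- Were `ξ` the maximum of `↓ δ`, the constant map on the nonempty `↓ β` would be cofinal.
      let (η , η<δ , ξ<η) = strict-bound (cofinalityAtLeast⇒¬cofinalMap cf≥κ β<κ)
                              (λ _ → ξ) (λ _ _ → ξ<δ)
      in η , ξ<η α α<β , η<δ

  -- Unbounded and closed sets

  unbounded⇒isSup : IsLimitOrdinal δ → {A : Pred L ℓ} →
    UnboundedIn (↓ δ) (A ∩ ↓ δ) → Satisfiable (A ∩ ↓ δ) × IsSup (A ∩ ↓ δ) δ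
  unbounded⇒isSup ((x , x<δ) , limit) unbounded =
    (let (ξ , ξ∈ , _) = unbounded x x<δ in ξ , ξ∈) ,
    (λ ξ ξ∈ → inj₁ (proj₂ ξ∈)) ,
    λ β β-upper → ≮⇒≥ λ β<δ →
      let (η , β<η , η<δ) = limit β β<δ
          (ξ , ξ∈ , η≤ξ)  = unbounded η η<δ
      in <⇒≱ (<-≤-trans β<η η≤ξ) (β-upper ξ ξ∈)

  isSup⇒approached : {A : Pred L ℓ} → IsSup A δ → α < δ → ∃[ ξ ] ξ ∈ A × α < ξ
  isSup⇒approached {α = α} (_ , δ-least) α<δ = by-contradiction λ none →
    <⇒≱ α<δ (δ-least α λ ξ ξ∈A → ≮⇒≥ λ α<ξ → none (ξ , ξ∈A , α<ξ))

  ¬unbounded⇒bounded : {A : Pred L ℓ} → ¬ UnboundedIn (↓ δ) (A ∩ ↓ δ) →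
    ∃[ θ ] θ < δ × (∀ ξ → ξ ∈ A → ξ < δ → ξ < θ)
  ¬unbounded⇒bounded ¬unbounded = by-contradiction λ ¬bounded → ¬unbounded λ β β<δ →
    by-contradiction λ none → ¬bounded (β , β<δ , λ ξ ξ∈A ξ<δ →
      ≰⇒> λ β≤ξ → none (ξ , (ξ∈A , ξ<δ) , β≤ξ))

  -- The closure of A, together with 0.
  cl : Pred L ℓ → Pred L ℓ
  cl A α = ∀ x → x < α → ∃[ y ] y ∈ A × x < y × y ≤ α

  ⊆-cl : ∀ {A} → A ⊆ cl A
  ⊆-cl {x = α} α∈A x x<α = α , α∈A , x<α , ≤-refl

  cl-isSup : ∀ {A} → IsSup (cl A ∩ ↓ α) α → α ∈ cl A
  cl-isSup sup x x<α =
    let (y , (y∈cl , y<α) , x<y) = isSup⇒approached sup x<α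
        (z , z∈A , x<z , z≤y)    = y∈cl x x<y
    in z , z∈A , x<z , inj₁ (≤-<-trans z≤y y<α)

  isSup-mono : {A B : Pred L ℓ} → A ⊆ B → B ⊆ ↓ α → IsSup A α → IsSup B α
  isSup-mono A⊆B B⊆↓α (_ , α-least) =
    (λ ξ ξ∈B → inj₁ (B⊆↓α ξ∈B)) , λ β β-upper → α-least β (λ ξ ξ∈A → β-upper ξ (A⊆B ξ∈A))

  -- If α is not in `A`, the points of `A` found above each β < α lie below α, so α is the supremum
  -- of `cl A ∩ ↓ α`. The least ordinal is no exception, because sup ∅ = 0.
  nacc-cl : ∀ {A} → nacc (cl A) ⊆ A
  nacc-cl {A} {α} (α∈cl , ¬acc) = by-contradiction λ α∉A →
    ¬acc (α∈cl , (λ ξ ξ∈ → inj₁ (proj₂ ξ∈)) , λ β β-upper → ≮⇒≥ λ β<α →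
      let (y , y∈A , β<y , y≤α) = α∈cl β β<α
          y<α = ≰⇒> λ α≤y → α∉A (subst (_∈ A) (≤-antisym y≤α α≤y) y∈A)
      in <⇒≱ β<y (β-upper y (⊆-cl {A} y∈A , y<α)))

  ↓-isClub : IsClubIn (↓ δ) (↓ δ)
  ↓-isClub = id , (λ β β<δ → β , β<δ , ≤-refl) , λ α α<δ _ _ → α<δ

  -- Walks along a ladder system

  module Walks (C : L → Pred L ℓ) (C-club : ∀ δ → IsClubIn (↓ δ) (C δ)) where

    IsStep : L → L → L → Set ℓ
    IsStep α β = IsLeast (λ ξ → ξ ∈ C β × α ≤ ξ)

    next : α < β → ∃[ ξ ] IsStep α β ξ
    next {α} {β} α<β =
      least _ (let (ξ , ξ∈Cβ , α≤ξ) = proj₁ (proj₂ (C-club β)) α α<β in ξ , ξ∈Cβ , α≤ξ)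

    C⊆↓ : ∀ {ξ} → ξ ∈ C β → ξ < β
    C⊆↓ {β} = proj₁ (C-club β)

    walk-step : ∀ α β → WfRec _<_ (λ _ → ℕ) β → Dec (α < β) → ℕ
    walk-step α β IH (yes α<β) = ℕ.suc (IH (C⊆↓ (proj₁ (proj₁ (proj₂ (next α<β))))))
    walk-step α β IH (no _)    = 0

    -- It is 0 if β ≤ α.
    walkLength : L → L → ℕ
    walkLength α = All.wfRec wellFounded _ (λ _ → ℕ) λ β IH → walk-step α β IH (α <? β)

    walkLength-unfold : ∀ α β →
      walkLength α β ≡ walk-step α β (λ {ξ} _ → walkLength α ξ) (α <? β)
    walkLength-unfold α β = FixPoint.unfold-wfRec wellFounded (λ _ → ℕ)
      (λ β IH → walk-step α β IH (α <? β)) (λ β IH≡ → ext β IH≡ (α <? β))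
      where
      ext : ∀ β {IH IH′ : WfRec _<_ (λ _ → ℕ) β} →
        (∀ {ξ} ξ<β → IH {ξ} ξ<β ≡ IH′ ξ<β) → ∀ d → walk-step α β IH d ≡ walk-step α β IH′ d
      ext β IH≡ (yes _) = cong ℕ.suc (IH≡ _)
      ext β IH≡ (no _)  = refl

    walkLength-step : ∀ {ξ} → α < β → IsStep α β ξ → walkLength α β ≡ ℕ.suc (walkLength α ξ)
    walkLength-step {α} {β} {ξ} α<β ξ-step = trans (walkLength-unfold α β) (by-step (α <? β))
      where
      by-step : ∀ d →
        walk-step α β (λ {ξ} _ → walkLength α ξ) d ≡ ℕ.suc (walkLength α ξ)
      by-step (yes α<β) =
        cong (ℕ.suc ∘ walkLength α) (IsLeast-unique (proj₂ (next α<β)) ξ-step)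
      by-step (no α≮β) = ⊥-elim (α≮β α<β)

    -- `C β` has no element in the interval from θ to δ, so its first element at or above such an α
    -- is its first element at or above δ.
    common-step : ∀ {θ} → δ < β → (∀ ξ → ξ ∈ C β → ξ < δ → ξ < θ) →
      ∃[ β′ ] δ ≤ β′ × β′ < β ×
        (∀ α → θ ≤ α → α < δ → walkLength α β ≡ ℕ.suc (walkLength α β′))
    common-step δ<β C∩δ<θ =
      let (β′ , (β′∈C , δ≤β′) , β′-least) = next δ<β
      in β′ , δ≤β′ , C⊆↓ β′∈C , λ α θ≤α α<δ →
        walkLength-step (<-trans α<δ δ<β)
          ((β′∈C , inj₁ (<-≤-trans α<δ δ≤β′)) ,
           λ ξ (ξ∈C , α≤ξ) → β′-least ξ
             (ξ∈C , ≮⇒≥ λ ξ<δ → <⇒≱ (C∩δ<θ ξ ξ∈C ξ<δ) (≤-trans θ≤α α≤ξ)))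

    Reaches : L → Pred L ℓ
    Reaches δ β = ∃[ τ ] δ ≤ τ × UnboundedIn (↓ δ) (C τ ∩ ↓ δ) ×
      (∃[ η ] η < δ × (∀ α → η ≤ α → α < δ → walkLength α τ ≤ℕ walkLength α β))

    -- Induction along the walk, which stops once a ladder is unbounded in δ, at the latest at δ
    -- itself. Otherwise `common-step` leads to a smaller ordinal still at or above δ.
    reach : IsLimitOrdinal δ → ∀ β → δ ≤ β → β ∈ Reaches δ
    reach {δ} ((x , x<δ) , _) = <-induction (λ β → δ ≤ β → β ∈ Reaches δ) step
      where
      Cδ-unbounded : UnboundedIn (↓ δ) (C δ ∩ ↓ δ)
      Cδ-unbounded β β<δ =
        let (ξ , ξ∈C , β≤ξ) = proj₁ (proj₂ (C-club δ)) β β<δ in ξ , (ξ∈C , C⊆↓ ξ∈C) , β≤ξ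

      step : ∀ β → (∀ {β′} → β′ < β → δ ≤ β′ → β′ ∈ Reaches δ) → δ ≤ β → β ∈ Reaches δ
      step β ih δ≤β with em {UnboundedIn (↓ δ) (C β ∩ ↓ δ)}
      ... | yes unbounded = β , δ≤β , unbounded , x , x<δ , λ _ _ _ → ℕ.≤-refl
      step β ih (inj₂ refl) | no ¬unbounded = ⊥-elim (¬unbounded Cδ-unbounded)
      step β ih (inj₁ δ<β)  | no ¬unbounded =
        let (θ , θ<δ , C∩δ<θ)                   = ¬unbounded⇒bounded ¬unbounded
            (β′ , δ≤β′ , β′<β , β→β′)           = common-step δ<β C∩δ<θ
            (τ , δ≤τ , unbounded , η , η<δ , le) = ih β′<β δ≤β′
            (σ , σ<δ , θ≤σ , η≤σ)               = join (↓ δ) θ η θ<δ η<δ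
        in τ , δ≤τ , unbounded , σ , σ<δ , λ α σ≤α α<δ →
          ℕ.≤-trans (le α (≤-trans η≤σ σ≤α) α<δ)
            (ℕ.≤-trans (ℕ.n≤1+n _) (ℕ.≤-reflexive (sym (β→β′ α (≤-trans θ≤σ σ≤α) α<δ))))

    -- By closedness, a ladder unbounded in the limit γ would contain γ.
    ∉-ladder⇒bounded : IsLimitOrdinal γ → γ < β → γ ∉ C β →
      ∃[ θ ] θ < γ × (∀ ξ → ξ ∈ C β → ξ < γ → ξ < θ)
    ∉-ladder⇒bounded {γ} {β} limit γ<β γ∉C = ¬unbounded⇒bounded λ unbounded →
      let (nonempty , sup) = unbounded⇒isSup limit unbounded
      in γ∉C (proj₂ (proj₂ (C-club β)) γ γ<β nonempty sup)

  -- A common form of both principles: in place of inaccessible or limit indices it admits the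
  -- indices of ladders unbounded in δ, which are those that `reach` produces.
  NotCovered : L → (L → Pred L ℓ) → L → Pred L ℓ → Set ℓ
  NotCovered κ C δ E =
    ∀ ζ → ζ < κ → (τ : L → L) → (∀ ε → ε < ζ → UnboundedIn (↓ δ) (C (τ ε) ∩ ↓ δ)) →
      ¬ BoundedIn (↓ δ) ((S≥ κ ∩ E ∩ ↓ δ) ∖ ⋃[ ζ ] C τ)

  Guesses : L → (L → Pred L ℓ) → Set (suc ℓ)
  Guesses κ C = ∀ (E : Pred L ℓ) → IsClubIn U E →
    ∃[ δ ] CofinalityAtLeast κ δ × NotCovered κ C δ E

  GuessingLadder : L → Set (suc ℓ)
  GuessingLadder κ = Σ[ C ∈ (L → Pred L ℓ) ] (∀ δ → IsClubIn (↓ δ) (C δ)) × Guesses κ C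

  -- Bounds and closure points below a regular uncountable λ.

  module Regular (regular : IsRegular U) (uncountable : IsUncountable U)
                 {κ : L} (2≤κ : AtLeastTwo κ) where

    upper-bound : ∀ ζ (f : L → L) → ∃[ β ] (∀ ξ → ξ < ζ → f ξ < β)
    upper-bound ζ f =
      let (β , _ , f<β) = strict-bound {P = λ _ → Lift ℓ ⊤}
            (λ (g , _ , g-cofinal) →
              proj₂ (proj₂ (proj₂ regular)) ζ tt (g , (λ _ → tt) , λ _ → g-cofinal (lift tt)))
            f (λ _ _ → lift tt)
      in β , f<β

    above : ∀ α → ∃[ β ] α < β
    above α = let (ξ , ζ , ξ<ζ , _) = 2≤κ
                  (β , const<β)     = upper-bound ζ (λ _ → α)
              in β , const<β ξ ξ<ζ

    -- The finite ordinals as elements of `L`. They turn sequences indexed by ℕ into maps on an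
    -- initial segment of `L`, to which `upper-bound` applies.
    enumeration : ℕ → L
    enumeration ℕ.zero    = proj₁ (least (λ _ → Lift ℓ ⊤) (κ , lift tt))
    enumeration (ℕ.suc n) = proj₁ (least (enumeration n <_) (above (enumeration n)))

    enumeration-suc : ∀ n → IsLeast (enumeration n <_) (enumeration (ℕ.suc n))
    enumeration-suc n = proj₂ (least (enumeration n <_) (above (enumeration n)))

    enumeration-mono : ∀ {m n} → m <ℕ n → enumeration m < enumeration n
    enumeration-mono {m} {ℕ.suc n} (s≤s m≤n) with ℕ.m≤n⇒m<n∨m≡n m≤n
    ... | inj₁ m<n  = <-trans (enumeration-mono m<n) (proj₁ (enumeration-suc n))
    ... | inj₂ refl = proj₁ (enumeration-suc n)

    enumeration-injective : ∀ {m n} → enumeration m ≡ enumeration n → m ≡ n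
    enumeration-injective {m} {n} eq with ℕ.<-cmp m n
    ... | tri< m<n _ _ = ⊥-elim (irrefl eq (enumeration-mono m<n))
    ... | tri≈ _ m≡n _ = m≡n
    ... | tri> _ _ n<m = ⊥-elim (irrefl (sym eq) (enumeration-mono n<m))

    enumeration-initial : ∀ n {α} → α < enumeration n → ∃[ m ] enumeration m ≡ α
    enumeration-initial ℕ.zero    {α} α<0 =
      ⊥-elim (<⇒≱ α<0 (proj₂ (proj₂ (least (λ _ → Lift ℓ ⊤) (κ , lift tt))) α (lift tt)))
    enumeration-initial (ℕ.suc n) {α} α<1+n
      with ≮⇒≥ {enumeration n} {α} (λ n<α → <⇒≱ α<1+n (proj₂ (enumeration-suc n) α n<α))
    ... | inj₁ α<n = enumeration-initial n α<n
    ... | inj₂ α≡n = n , sym α≡n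

    -- The finite ordinals form an initial segment. If unbounded, it would be all of `L`, and
    -- `index` would inject `L` into ℕ.
    enumeration-bounded : ∃[ ω ] (∀ n → enumeration n < ω)
    enumeration-bounded = by-contradiction λ unbounded →
      let index : ∀ α → ∃[ n ] enumeration n ≡ α
          index α = by-contradiction λ α∉ → unbounded (α , λ n →
            ≰⇒> λ { (inj₁ α<n) → α∉ (enumeration-initial n α<n)
                  ; (inj₂ α≡n) → α∉ (n , sym α≡n) })
      in uncountable (proj₁ ∘ index , λ {α} {β} _ _ m≡n →
           trans (sym (proj₂ (index α))) (trans (cong enumeration m≡n) (proj₂ (index β))))

    sequence-bounded : (s : ℕ → L) → ∃[ β ] (∀ n → s n < β)
    sequence-bounded s =
      let (ω , n<ω) = enumeration-bounded
          (f , f-correct) = choose {A = λ ξ → ∃[ n ] enumeration n ≡ ξ}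
            {R = λ ξ η → ∃[ n ] enumeration n ≡ ξ × s n ≡ η} (λ ξ (n , n≡ξ) → s n , n , n≡ξ , refl)
          (β , f<β) = upper-bound ω f
      in β , λ n →
        let (m , m≡n , sm≡f) = f-correct (enumeration n) (n , refl)
        in subst (_< β) (trans (sym sm≡f) (cong s (enumeration-injective m≡n)))
             (f<β (enumeration n) (n<ω n))

    closure-points-club : (f : L → L) → IsClubIn U (λ δ → ∀ η → η < δ → f η ≤ δ)
    closure-points-club f = (λ _ → tt) , (λ α _ → unbounded α) , λ α _ _ sup η η<α →
      let (ξ , (ξ-closed , ξ<α) , η<ξ) = isSup⇒approached sup η<α
      in inj₁ (≤-<-trans (ξ-closed η η<ξ) ξ<α)
      where
      unbounded : ∀ α → ∃[ δ ] (∀ η → η < δ → f η ≤ δ) × α ≤ δ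
      unbounded α =
        -- `σ` is the supremum of `s`. An η < σ lies below some `s n`, and `s (suc n)` bounds `f` on
        -- `↓ s n`.
        let (σ , s≤σ , σ-least) = least (λ β → ∀ n → s n ≤ β)
              (let (β , s<β) = sequence-bounded s in β , λ n → inj₁ (s<β n))
        in σ , (λ η η<σ → by-contradiction λ fη≰σ → <⇒≱ η<σ (σ-least η λ n →
             ≮⇒≥ λ η<sn → fη≰σ
               (≤-trans (inj₁ (proj₂ (upper-bound (s n) f) η η<sn)) (s≤σ (ℕ.suc n))))) ,
           s≤σ 0
        where
        s : ℕ → L
        s ℕ.zero    = α
        s (ℕ.suc n) = proj₁ (upper-bound (s n) f)

    -- Shortening the walks to small families.

    module Colouring (C : L → Pred L ℓ) (C-club : ∀ δ → IsClubIn (↓ δ) (C δ))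
                     (guess : Guesses κ C) where
      open Walks C C-club

      Shortens : L → (L → L) → Pred L ℓ
      Shortens ζ b γ = Σ[ b′ ∈ (L → L) ] (∀ ε → ε < ζ → γ ≤ b′ ε) ×
        (∃[ σ ] σ < γ × (∀ α → σ ≤ α → α < γ → ∀ ε → ε < ζ →
          walkLength α (b′ ε) <ℕ walkLength α (b ε)))

      -- Since ζ < κ ≤ cf(γ), the thresholds of the individual walks have a common bound below γ.
      shortens : ∀ {b : L → L} → CofinalityAtLeast κ γ → ζ < κ →
        (∀ ε → ε < ζ → ∃[ β′ ] γ ≤ β′ × (∃[ σ ] σ < γ ×
          (∀ α → σ ≤ α → α < γ → walkLength α β′ <ℕ walkLength α (b ε)))) →
        γ ∈ Shortens ζ b
      shortens {γ} {ζ} cfγ≥κ ζ<κ shorter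
        with choose {A = ↓ ζ} shorter
      ... | b′ , b′-correct
        with choose {A = ↓ ζ} (λ ε ε<ζ → proj₂ (b′-correct ε ε<ζ))
      ... | σ , σ-correct
        with strict-bound (cofinalityAtLeast⇒¬cofinalMap cfγ≥κ ζ<κ)
               σ (λ ε ε<ζ → proj₁ (σ-correct ε ε<ζ))
      ... | σ* , σ*<γ , σ<σ* =
        b′ , (λ ε ε<ζ → proj₁ (b′-correct ε ε<ζ)) , σ* , σ*<γ , λ α σ*≤α α<γ ε ε<ζ →
          proj₂ (σ-correct ε ε<ζ) α (≤-trans (inj₁ (σ<σ* ε ε<ζ)) σ*≤α) α<γ

      -- `τ` is fixed before any γ is considered, so that the guessing principle can supply a γ
      -- outside the ladders `C (τ ε)`.
      shortens-off-ladders : ∀ {b : L → L} → CofinalityAtLeast κ δ → ζ < κ →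
        (∀ ε → ε < ζ → δ ≤ b ε) →
        Σ[ τ ∈ (L → L) ] (∀ ε → ε < ζ → UnboundedIn (↓ δ) (C (τ ε) ∩ ↓ δ)) ×
          (∃[ η ] η < δ × (∀ γ → η ≤ γ → γ < δ → CofinalityAtLeast κ γ →
            γ ∉ ⋃[ ζ ] C τ → γ ∈ Shortens ζ b))
      shortens-off-ladders {δ} {ζ} {b} cfδ≥κ ζ<κ δ≤b
        with choose {A = ↓ ζ}
               (λ ε ε<ζ → reach (cofinalityAtLeast⇒limit 2≤κ cfδ≥κ) (b ε) (δ≤b ε ε<ζ))
      ... | τ , reached
        with choose {A = ↓ ζ} (λ ε ε<ζ → proj₂ (proj₂ (reached ε ε<ζ)))
      ... | η , η-correct
        with strict-bound (cofinalityAtLeast⇒¬cofinalMap cfδ≥κ ζ<κ)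
               η (λ ε ε<ζ → proj₁ (η-correct ε ε<ζ))
      ... | η* , η*<δ , η<η* =
        τ , (λ ε ε<ζ → proj₁ (proj₂ (reached ε ε<ζ))) , η* , η*<δ , off-ladders
        where
        off-ladders : ∀ γ → η* ≤ γ → γ < δ → CofinalityAtLeast κ γ →
          γ ∉ ⋃[ ζ ] C τ → γ ∈ Shortens ζ b
        off-ladders γ η*≤γ γ<δ cfγ≥κ γ∉⋃ = shortens cfγ≥κ ζ<κ shorter
          where
          shorter : ∀ ε → ε < ζ → ∃[ β′ ] γ ≤ β′ × (∃[ σ ] σ < γ ×
            (∀ α → σ ≤ α → α < γ → walkLength α β′ <ℕ walkLength α (b ε)))
          shorter ε ε<ζ with <-≤-trans γ<δ (proj₁ (reached ε ε<ζ))
          ... | γ<τ with ∉-ladder⇒bounded (cofinalityAtLeast⇒limit 2≤κ cfγ≥κ) γ<τ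
                           (λ γ∈C → γ∉⋃ (ε , ε<ζ , γ∈C))
          ... | θ , θ<γ , C∩γ<θ with common-step γ<τ C∩γ<θ
                                   | join (↓ γ) (η ε) θ (<-≤-trans (η<η* ε ε<ζ) η*≤γ) θ<γ
          ... | β′ , γ≤β′ , _ , τ→β′ | σ , σ<γ , η≤σ , θ≤σ =
            β′ , γ≤β′ , σ , σ<γ , λ α σ≤α α<γ →
              -- The step from `τ ε` to `β′` accounts for the strictness.
              subst (_≤ℕ walkLength α (b ε)) (τ→β′ α (≤-trans θ≤σ σ≤α) α<γ)
                (proj₂ (η-correct ε ε<ζ) α (≤-trans η≤σ σ≤α) (<-trans α<γ γ<δ))

      -- e i enumerates, over the ordinals below Z i, a family of fewer than κ
      -- ordinals, each of them at least i.
      IsTailFamily : (L → L) → (L → L → L) → Set ℓ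
      IsTailFamily Z e = ∀ i → Z i < κ × (∀ ε → ε < Z i → i ≤ e i ε)

      -- `e′` is a shortened family for `e j`. The γ of `Shortens` is forgotten in favour of i, so
      -- that one threshold η can be sought that serves every i.
      Descends : (L → L) → (L → L → L) → L → Pred L ℓ
      Descends Z e η i = ∃[ j ] i ≤ j × Σ[ e′ ∈ (L → L) ]
        (∀ ε → ε < Z j → i ≤ e′ ε) ×
        (∀ α → η ≤ α → α < i → ∀ ε → ε < Z j → walkLength α (e′ ε) <ℕ walkLength α (e j ε))

      -- If each η failed at some i = f η, a guess at the club of closure points
      -- of f would contradict the failure.
      descent : ∀ Z e → IsTailFamily Z e → ∃[ η ] (∀ i → i ∈ Descends Z e η)
      descent Z e tail = by-contradiction λ none →
        contradiction λ η → by-contradiction λ all →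
          none (η , λ i → by-contradiction λ ¬descends → all (i , ¬descends))
        where
        descends : ∀ {i σ} → γ < δ → i ≤ γ → (s : γ ∈ Shortens (Z δ) (e δ)) →
          proj₁ (proj₂ (proj₂ s)) ≡ σ → i ∈ Descends Z e σ
        descends {δ = δ} γ<δ i≤γ (e′ , γ≤e′ , σ , _ , shorter) refl =
          δ , ≤-trans i≤γ (inj₁ γ<δ) ,
          e′ , (λ ε ε<Z → ≤-trans i≤γ (γ≤e′ ε ε<Z)) ,
          λ α σ≤α α<i → shorter α σ≤α (<-≤-trans α<i i≤γ)

        contradiction : ¬ (∀ η → ∃[ i ] i ∉ Descends Z e η)
        contradiction blocked = refute (guess E (closure-points-club f))
          where
          f : L → L
          f η = proj₁ (blocked η)

          E : Pred L ℓ
          E δ = ∀ η → η < δ → f η ≤ δ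

          off-ladders⇒⊥ : γ < δ → γ ∈ E → γ ∉ Shortens (Z δ) (e δ)
          off-ladders⇒⊥ γ<δ γ∈E s@(_ , _ , σ , σ<γ , _) =
            -- As σ is below the closure point γ, `f σ ≤ γ`; with δ as the index j this gives what
            -- `blocked σ` denies.
            proj₂ (blocked σ) (descends γ<δ (γ∈E σ σ<γ) s refl)

          refute : ¬ (∃[ δ ] CofinalityAtLeast κ δ × NotCovered κ C δ E)
          refute (δ , cfδ≥κ , not-covered) =
            let (Zδ<κ , δ≤e) = tail δ
                (τ , τ-unbounded , η , η<δ , off-ladders) =
                  shortens-off-ladders {b = e δ} cfδ≥κ Zδ<κ δ≤e
            in not-covered (Z δ) Zδ<κ τ τ-unbounded
              (η , η<δ , λ {γ} ((cfγ≥κ , γ∈E , γ<δ) , γ∉⋃) → ≰⇒> λ η≤γ →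
                off-ladders⇒⊥ γ<δ γ∈E (off-ladders γ η≤γ γ<δ cfγ≥κ γ∉⋃))

      -- Induction on n for all tail families at once: the shortened families from `descent` again
      -- form a tail family, and the walks to the original families are longer by at least one.
      long-walks : ∀ n Z e → IsTailFamily Z e → ∃[ η ] (∀ i → ∃[ j ] i ≤ j ×
        (∀ α → η ≤ α → α < i → ∀ ε → ε < Z j → n ≤ℕ walkLength α (e j ε)))
      long-walks ℕ.zero    Z e tail = κ , λ i → i , ≤-refl , λ _ _ _ _ _ → z≤n
      long-walks (ℕ.suc n) Z e tail =
        let (η , descends) = descent Z e tail
            J = proj₁ ∘ descends
            e′ = λ i → proj₁ (proj₂ (proj₂ (descends i)))
            (η′ , long) = long-walks n (Z ∘ J) e′
              (λ i → proj₁ (tail (J i)) , proj₁ (proj₂ (proj₂ (proj₂ (descends i)))))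
            (σ , _ , η≤σ , η′≤σ) = join U η η′ tt tt
        in σ , λ i →
          let (i′ , i≤i′ , n≤) = long i
              (j , i′≤j , _ , _ , shorter) = descends i′
          in j , ≤-trans i≤i′ i′≤j , λ α σ≤α α<i ε ε<Z →
            ℕ.≤-<-trans (n≤ α (≤-trans η′≤σ σ≤α) α<i ε ε<Z)
              (shorter α (≤-trans η≤σ σ≤α) (<-≤-trans α<i i≤i′) ε ε<Z)

      -- At least one summand is 0, so the sum is the length of the walk from the larger argument to
      -- the smaller, in a visibly symmetric form.
      colour : L → L → ℕ
      colour α β = walkLength α β +ℕ walkLength β α

      colour-sym : ∀ α β → colour α β ≡ colour β α
      colour-sym α β = ℕ.+-comm (walkLength α β) (walkLength β α)

      -- Thinning out a sequence of disjoint small sets.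

      module _ (w : L → Pred L ℓ) (disjoint : ∀ i j → i ≢ j → w i ⊥ w j)
               (small : ∀ i → CardinalityBelow (w i) κ) where

        enumerate : ∀ i → ∃[ μ ] μ < κ × Σ[ e ∈ (L → L) ]
          (∀ ε → ε < μ → e ε ∈ w i) × (∀ α → α ∈ w i → ∃[ ε ] ε < μ × e ε ≡ α)
        enumerate i =
          let (μ , μ<κ , _ , f , f∈μ , f-injective , f-surjective) = small i
              (e , e-correct) = choose {A = ↓ μ} (λ ε ε<μ → f-surjective ε<μ)
          in μ , μ<κ , e , (λ ε ε<μ → proj₁ (e-correct ε ε<μ)) , λ α α∈w →
            let (e∈w , fe≡f) = e-correct (f α) (f∈μ α∈w)
            in f α , f∈μ α∈w , f-injective e∈w α∈w fe≡f

        w-bounded : ∀ i → ∃[ β ] (∀ α → α ∈ w i → α < β)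
        w-bounded i =
          let (μ , _ , e , _ , e-onto) = enumerate i
              (β , e<β)                = upper-bound μ e
          in β , λ α α∈w → let (ε , ε<μ , eε≡α) = e-onto α α∈w in subst (_< β) eε≡α (e<β ε ε<μ)

        Above : L → Pred L ℓ
        Above i k = ∀ α → α ∈ w k → i ≤ α

        -- By disjointness each α < i lies in at most one `w k`. By regularity the indices k so
        -- obtained are bounded, and any k beyond the bound works.
        w-above : ∀ i → ∃[ k ] i ≤ k × k ∈ Above i
        w-above i =
          let (f , f-correct) = choose {A = λ α → ∃[ k ] α ∈ w k} {R = λ α k → α ∈ w k}
                (λ α α∈⋃ → α∈⋃)
              (b , f<b) = upper-bound i f
              (k , _ , i≤k , b≤k) = join U i b tt tt
          in k , i≤k , λ α α∈wk → ≮⇒≥ λ α<i →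
            disjoint k (f α) (λ k≡fα → irrefl (sym k≡fα) (<-≤-trans (f<b α α<i) b≤k))
              (α∈wk , f-correct α (k , α∈wk))

        Separated : ℕ → L → L → Set ℓ
        Separated n i j =
          (∀ α β → α ∈ w i → β ∈ w j → α < β) × (∀ α β → α ∈ w i → β ∈ w j → n <ℕ colour α β)

        -- Since `w (k i)` lies above i, the enumerations of these sets form a tail family for
        -- `long-walks`.
        long-tails : ∀ n → ∃[ η ] (∀ i → ∃[ k ] i ≤ k × k ∈ Above i ×
          (∀ α β → η ≤ α → α < i → β ∈ w k → n <ℕ colour α β))
        long-tails n =
          let k = proj₁ ∘ w-above
              μ = proj₁ ∘ enumerate ∘ k
              e = λ i → proj₁ (proj₂ (proj₂ (enumerate (k i))))
              (η , long) = long-walks (ℕ.suc n) μ e λ i →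
                let (_ , μ<κ , _ , e∈w , _) = enumerate (k i)
                in μ<κ , λ ε ε<μ → proj₂ (proj₂ (w-above i)) _ (e∈w ε ε<μ)
          in η , λ i →
            let (j , i≤j , n<)    = long i
                (_ , j≤k , k-above) = w-above j
            in k j , ≤-trans i≤j j≤k , (λ α α∈w → ≤-trans i≤j (k-above α α∈w)) ,
              λ α β η≤α α<i β∈w →
                let (ε , ε<μ , eε≡β) = proj₂ (proj₂ (proj₂ (proj₂ (enumerate (k j))))) β β∈w
                in ℕ.<-≤-trans
                  (subst (λ β → n <ℕ walkLength α β) eε≡β (n< α η≤α α<i ε ε<μ))
                  (ℕ.m≤m+n _ _)

        separated-sequence : ∀ n →
          Σ[ g ∈ (L → L) ] (∀ ξ η → η < ξ → g η < g ξ × Separated n (g η) (g ξ))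
        separated-sequence n =
          let (θ , long) = long-tails n
              -- All chosen sets stay above `θ`, because `long` controls only α at or above `θ`.
              (g , g-correct) = dependent-choice (Above θ) (λ i j → i < j × Separated n i j)
                λ ξ y y∈Above →
                  let (b , y<b)  = upper-bound ξ y
                      (b′ , w<b′) = upper-bound ξ (proj₁ ∘ w-bounded ∘ y)
                      (c , _ , b≤c , b′≤c) = join U b b′ tt tt
                      -- `d` lies above all earlier indices and all elements of the earlier sets,
                      -- and is at least `θ`.
                      (d , _ , c≤d , θ≤d) = join U c θ tt tt
                      (k , d≤k , k-above , n<) = long d
                      wy<d = λ η η<ξ α α∈w → <-≤-trans
                        (<-trans (proj₂ (w-bounded (y η)) α α∈w) (w<b′ η η<ξ)) (≤-trans b′≤c c≤d)
                  in k , (λ α α∈w → ≤-trans θ≤d (k-above α α∈w)) , λ η η<ξ →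
                    <-≤-trans (y<b η η<ξ) (≤-trans b≤c (≤-trans c≤d d≤k)) ,
                    (λ α β α∈w β∈w → <-≤-trans (wy<d η η<ξ α α∈w) (k-above β β∈w)) ,
                    (λ α β α∈w β∈w → n< α β (y∈Above η η<ξ α α∈w) (wy<d η η<ξ α α∈w) β∈w)
          in g , λ ξ → proj₂ (g-correct ξ)

        homogeneous : ∀ n → Σ[ Y ∈ Pred L ℓ ] HasCardinality Y U ×
          (∀ i j → i ∈ Y → j ∈ Y → i < j → Separated n i j)
        homogeneous n =
          let (g , g-correct) = separated-sequence n
              g-mono : ∀ {η ξ} → η < ξ → g η < g ξ
              g-mono η<ξ = proj₁ (g-correct _ _ η<ξ)
              g-reflects : ∀ {η ξ} → g η < g ξ → η < ξ
              g-reflects gη<gξ = ≰⇒> λ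
                { (inj₁ ξ<η) → <⇒≱ gη<gξ (inj₁ (g-mono ξ<η))
                ; (inj₂ refl) → irrefl refl gη<gξ }
              g-injective : ∀ {η ξ} → g η ≡ g ξ → η ≡ ξ
              g-injective gη≡gξ = ≤-antisym
                (≮⇒≥ λ ξ<η → irrefl (sym gη≡gξ) (g-mono ξ<η))
                (≮⇒≥ λ η<ξ → irrefl gη≡gξ (g-mono η<ξ))
              Y = λ y → ∃[ ξ ] g ξ ≡ y
              (f , g∘f) = choose {A = Y} {R = λ y ξ → g ξ ≡ y} (λ y y∈Y → y∈Y)
          in Y ,
            ( proj₁ regular
            , f , (λ _ → tt)
            , (λ x∈Y y∈Y fx≡fy → trans (sym (g∘f _ x∈Y)) (trans (cong g fx≡fy) (g∘f _ y∈Y)))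
            , λ {ξ} _ → g ξ , (ξ , refl) , g-injective (g∘f (g ξ) (ξ , refl))) ,
            λ { _ _ (η , refl) (ξ , refl) gη<gξ → proj₂ (g-correct ξ η (g-reflects gη<gξ)) }

  -- Ladder systems from the guessing principles

  -- Ladders of `C′` unbounded in δ have indices in `T`, where `C′` lies inside `C`. So a bound on
  -- what they leave of `S≥ κ ∩ E` also bounds what `C` leaves of `B`.
  guess-on-extension : ∀ {T : Pred L ℓ} {C′} C {E} → (∀ {τ} → τ ∈ T → C′ τ ⊆ C τ) →
    (∀ {τ} → UnboundedIn (↓ δ) (C′ τ ∩ ↓ δ) → τ ∈ T) →
    {B : Pred L ℓ} → B ∩ ↓ δ ⊆ S≥ κ ∩ E ∩ ↓ δ →
    (∀ ζ → ζ < κ → (τ : L → L) → (∀ ε → ε < ζ → τ ε ∈ T) →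
      ¬ BoundedIn (↓ δ) ((B ∩ ↓ δ) ∖ ⋃[ ζ ] C τ)) →
    NotCovered κ C′ δ E
  guess-on-extension C C′⊆C τ∈T B⊆ not-bounded ζ ζ<κ τ unbounded (β , β<δ , bounded) =
    not-bounded ζ ζ<κ τ (λ ε ε<ζ → τ∈T (unbounded ε ε<ζ))
      (β , β<δ , λ (γ∈B , γ∉⋃) → bounded (B⊆ γ∈B , λ (ε , ε<ζ , γ∈C′) →
        γ∉⋃ (ε , ε<ζ , C′⊆C (τ∈T (unbounded ε ε<ζ)) γ∈C′)))

  ClubAvoiding : Pred L ℓ → L → Set (suc ℓ)
  ClubAvoiding A β = Σ[ D ∈ Pred L ℓ ] IsClubIn (↓ β) D ×
    (∀ δ → δ ∈ A → ¬ UnboundedIn (↓ δ) (D ∩ ↓ δ))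

  extend-ladder : ∀ (T A : Pred L ℓ) (C : L → Pred L ℓ) →
    (∀ δ → δ ∈ T → IsClubIn (↓ δ) (C δ)) → (∀ β → β ∉ T → ClubAvoiding A β) →
    Σ[ C′ ∈ (L → Pred L ℓ) ] (∀ δ → IsClubIn (↓ δ) (C′ δ)) ×
      (∀ {τ} → τ ∈ T → C′ τ ⊆ C τ) ×
      (∀ {δ τ} → δ ∈ A → UnboundedIn (↓ δ) (C′ τ ∩ ↓ δ) → τ ∈ T)
  extend-ladder T A C C-club avoiding =
    (λ β → ladder β em) , (λ β → ladder-club β em) , (λ {β} → ladder⊆C β em) ,
    λ {_} {β} → ladder-avoids β em
    where
    ladder : ∀ β → Dec (β ∈ T) → Pred L ℓ
    ladder β (yes _)  = C β
    ladder β (no β∉T) = proj₁ (avoiding β β∉T)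

    ladder-club : ∀ β d → IsClubIn (↓ β) (ladder β d)
    ladder-club β (yes β∈T) = C-club β β∈T
    ladder-club β (no β∉T)  = proj₁ (proj₂ (avoiding β β∉T))

    ladder⊆C : ∀ β d → β ∈ T → ladder β d ⊆ C β
    ladder⊆C β (yes _)  _   = id
    ladder⊆C β (no β∉T) β∈T = ⊥-elim (β∉T β∈T)

    ladder-avoids : ∀ β d → δ ∈ A → UnboundedIn (↓ δ) (ladder β d ∩ ↓ δ) → β ∈ T
    ladder-avoids β (yes β∈T) _ _ = β∈T
    ladder-avoids {δ} β (no β∉T) δ∈A unbounded =
      ⊥-elim (proj₂ (proj₂ (avoiding β β∉T)) δ δ∈A unbounded)

  -- The club holds the maximum of `↓ β`, or is empty if β = 0; a set with at most one element is
  -- not unbounded in a limit.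
  nonlimit⇒clubAvoidingLimits : ∀ β → ¬ IsLimitOrdinal β → ClubAvoiding IsLimitOrdinal β
  nonlimit⇒clubAvoidingLimits β ¬limit = Max , (proj₁ , unbounded , closed) , avoids
    where
    Max : Pred L ℓ
    Max ξ = ξ < β × (∀ η → η < β → η ≤ ξ)

    unbounded : UnboundedIn (↓ β) Max
    unbounded α α<β = by-contradiction λ none → ¬limit ((α , α<β) , λ ξ ξ<β →
      by-contradiction λ no-η →
        let max = λ η η<β → ≮⇒≥ λ ξ<η → no-η (η , ξ<η , η<β)
        in none (ξ , (ξ<β , max) , max α α<β))

    closed : ClosedIn (↓ β) Max
    closed α α<β (x , (_ , x-max) , x<α) _ = ⊥-elim (<⇒≱ x<α (x-max α α<β))

    avoids : ∀ δ → δ ∈ IsLimitOrdinal → ¬ UnboundedIn (↓ δ) (Max ∩ ↓ δ)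
    avoids δ ((x , x<δ) , limit) unbounded =
      let (ξ , ((_ , ξ-max) , ξ<δ) , _) = unbounded x x<δ
          (η , ξ<η , η<δ)               = limit ξ ξ<δ
          (ξ′ , ((ξ′<β , _) , _) , η≤ξ′) = unbounded η η<δ
      in <⇒≱ (<-≤-trans ξ<η η≤ξ′) (ξ-max ξ′ ξ′<β)

  oplus⇒guessingLadder : AtLeastTwo κ → Oplus κ → GuessingLadder κ
  oplus⇒guessingLadder 2≤κ (C , C-club , guess) =
    let (C′ , C′-club , C′⊆C , τ-limit) =
          extend-ladder IsLimitOrdinal IsLimitOrdinal C C-club nonlimit⇒clubAvoidingLimits
    in C′ , C′-club , λ E E-club →
      let (δ , _ , cfδ≥κ , not-bounded) = guess E E-club
      in δ , cfδ≥κ , guess-on-extension C C′⊆C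
        (τ-limit (cofinalityAtLeast⇒limit 2≤κ cfδ≥κ)) {B = S≥ _ ∩ E}
        (λ ((cf , γ∈E) , γ<δ) → cf , γ∈E , γ<δ)
        λ ζ ζ<κ τ τ∈ (β , β<δ , bounded) → not-bounded ζ ζ<κ τ τ∈
          (β , β<δ , λ ((cf , γ∈E , γ<δ) , γ∉⋃) → bounded (((cf , γ∈E) , γ<δ) , γ∉⋃))

  -- Limitness is carried along explicitly; at the guessed δ it comes from cf(δ) ≥ κ ≥ 2.
  InaccessibleLimit : Pred L ℓ
  InaccessibleLimit δ = δ ∈ S-in × IsLimitOrdinal δ

  small⇒clubAvoiding : ∀ β →
    (∀ δ → δ ∈ S-in → ¬ (↓ δ ⊆ ↓ β)) → ClubAvoiding InaccessibleLimit β
  small⇒clubAvoiding β small = ↓ β , ↓-isClub , λ δ (δ-in , _) unbounded →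
    small δ δ-in λ {x} x<δ → let (ξ , (ξ<β , _) , x≤ξ) = unbounded x x<δ in ≤-<-trans x≤ξ ξ<β

  -- The club is the closure of the range of `f`, from ζ on. Were it unbounded in δ, then ζ < δ and
  -- the values of `f` below δ would be cofinal in δ, against the regularity of δ.
  singular⇒clubAvoiding : ∀ β → ζ < β → CofinalMap (↓ ζ) (↓ β) →
    ClubAvoiding InaccessibleLimit β
  singular⇒clubAvoiding {ζ} β ζ<β (f , f<β , f-cofinal) =
    D , (proj₁ ∘ proj₂ , unbounded , closed) , avoids
    where
    Range : Pred L ℓ
    Range α = ∃[ ξ ] ξ < ζ × f ξ ≡ α

    D : Pred L ℓ
    D α = ζ ≤ α × α < β × α ∈ cl Range

    unbounded : UnboundedIn (↓ β) D
    unbounded α α<β =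
      let (γ , γ<β , α≤γ , ζ≤γ) = join (↓ β) α ζ α<β ζ<β
          (ξ , ξ<ζ , γ≤fξ)      = f-cofinal γ<β
      in f ξ , (≤-trans ζ≤γ γ≤fξ , f<β ξ<ζ , ⊆-cl {Range} (ξ , ξ<ζ , refl)) , ≤-trans α≤γ γ≤fξ

    closed : ClosedIn (↓ β) D
    closed α α<β (x , (ζ≤x , _) , x<α) sup =
      ≤-trans ζ≤x (inj₁ x<α) , α<β ,
      cl-isSup {A = Range}
        (isSup-mono (λ ((_ , _ , ∈cl) , ξ<α) → ∈cl , ξ<α) proj₂ sup)

    avoids : ∀ δ → δ ∈ InaccessibleLimit → ¬ UnboundedIn (↓ δ) (D ∩ ↓ δ)
    avoids δ ((_ , (_ , _ , _ , minimal) , _) , (x , x<δ) , limit) D-unbounded =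
      let (ξ , ((ζ≤ξ , _) , ξ<δ) , _) = D-unbounded x x<δ
          ζ<δ = ≤-<-trans ζ≤ξ ξ<δ
          -- Values of `f` at or above δ are replaced by ζ < δ, to obtain a map into `↓ δ`.
          (g , g-correct) = choose {A = ↓ ζ} {R = λ ξ η → η < δ × (f ξ < δ → f ξ ≡ η)} λ ξ _ →
            truncate ξ ζ<δ (f ξ <? δ)
      in minimal ζ ζ<δ
        ( g , (λ ξ<ζ → proj₁ (g-correct _ ξ<ζ))
        , λ {y} y<δ →
            let (y′ , y<y′ , y′<δ)                 = limit y y<δ
                (α , ((_ , _ , α∈cl) , α<δ) , y′≤α) = D-unbounded y′ y′<δ
                (_ , (ξ , ξ<ζ , fξ≡z) , y<z , z≤α) = α∈cl y (<-≤-trans y<y′ y′≤α)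
                fξ<δ = subst (_< δ) (sym fξ≡z) (≤-<-trans z≤α α<δ)
            in ξ , ξ<ζ , inj₁ (subst (y <_) (trans (sym fξ≡z) (proj₂ (g-correct ξ ξ<ζ) fξ<δ)) y<z))
      where
      truncate : ∀ ξ → ζ < δ → Dec (f ξ < δ) → ∃[ η ] η < δ × (f ξ < δ → f ξ ≡ η)
      truncate ξ ζ<δ (yes fξ<δ) = f ξ , fξ<δ , λ _ → refl
      truncate ξ ζ<δ (no fξ≮δ)  = ζ , ζ<δ , λ fξ<δ → ⊥-elim (fξ≮δ fξ<δ)

  -- If the interval from μ to β is unbounded in an inaccessible δ, then μ < δ ≤ β. Being a
  -- cardinal, δ is not below β, and δ = β contradicts `β ∉ S-in`.
  successorCardinal⇒clubAvoiding : ∀ {μ} β → β ∉ S-in → μ < β →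
    ¬ (∃[ ν ] ν < β × IsCardinal (↓ ν) × μ < ν) → ClubAvoiding InaccessibleLimit β
  successorCardinal⇒clubAvoiding {μ} β β∉S-in μ<β no-cardinal =
    D , (proj₂ , unbounded , closed) , avoids
    where
    D : Pred L ℓ
    D α = μ ≤ α × α < β

    unbounded : UnboundedIn (↓ β) D
    unbounded α α<β =
      let (γ , γ<β , α≤γ , μ≤γ) = join (↓ β) α μ α<β μ<β in γ , (μ≤γ , γ<β) , α≤γ

    closed : ClosedIn (↓ β) D
    closed α α<β (x , (μ≤x , _) , x<α) _ = ≤-trans μ≤x (inj₁ x<α) , α<β

    avoids : ∀ δ → δ ∈ InaccessibleLimit → ¬ UnboundedIn (↓ δ) (D ∩ ↓ δ)
    avoids δ (δ-in@(_ , (cardinal , _) , _) , (x , x<δ) , _) D-unbounded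
      with compare δ β | D-unbounded x x<δ
    ... | tri< δ<β _ _  | ξ , ((μ≤ξ , _) , ξ<δ) , _ =
      no-cardinal (δ , δ<β , cardinal , ≤-<-trans μ≤ξ ξ<δ)
    ... | tri≈ _ refl _ | _ = β∉S-in δ-in
    ... | tri> _ _ β<δ  | _ =
      let (ξ , ((_ , ξ<β) , _) , β≤ξ) = D-unbounded β β<δ in <⇒≱ ξ<β β≤ξ

  -- The cases are the ways in which inaccessibility fails. A β that is not a cardinal counts as
  -- singular, since a bijection from a smaller `↓ α` is a cofinal map.
  noninaccessible⇒clubAvoiding : ∀ β → β ∉ S-in → ClubAvoiding InaccessibleLimit β
  noninaccessible⇒clubAvoiding β β∉S-in
    with em {IsCountable (↓ β)} | em {IsInfinite (↓ β)} | em {∃[ ζ ] ζ < β × CofinalMap (↓ ζ) (↓ β)}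
       | em {∃[ μ ] μ < β × ¬ (∃[ ν ] ν < β × IsCardinal (↓ ν) × μ < ν)}
  ... | yes (f , f-injective) | _ | _ | _ = small⇒clubAvoiding β
    λ δ (uncountable , _) δ⊆β →
      uncountable (f , λ x<δ y<δ → f-injective (δ⊆β x<δ) (δ⊆β y<δ))
  ... | no _ | no finite | _ | _ = small⇒clubAvoiding β
    λ δ (_ , (_ , (f , f∈δ , f-injective) , _) , _) δ⊆β → finite (f , δ⊆β ∘ f∈δ , f-injective)
  ... | no _ | yes _ | yes (ζ , ζ<β , cofinal) | _ = singular⇒clubAvoiding β ζ<β cofinal
  ... | no _ | yes _ | no _ | yes (μ , μ<β , no-cardinal) =
    successorCardinal⇒clubAvoiding β β∉S-in μ<β no-cardinal
  ... | no uncountable | yes infinite | no regular | no limit = ⊥-elim (β∉S-in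
    (uncountable , (cardinal , infinite , (id , id , λ {α} α<β → α , α<β , ≤-refl) ,
        λ ζ ζ<β cofinal → regular (ζ , ζ<β , cofinal)) ,
      cardinal , λ μ μ<β _ → by-contradiction λ none → limit (μ , μ<β , none)))
    where
    cardinal : IsCardinal (↓ β)
    cardinal α α<β (f , f∈β , _ , f-surjective) = regular (α , α<β , f , f∈β ,
      λ y<β → let (x , x<α , fx≡y) = f-surjective y<β in x , x<α , inj₂ (sym fx≡y))

  tail-isClub : ∀ {E : Pred L ℓ} μ → IsClubIn U E → IsClubIn U (E ∩ (μ ≤_))
  tail-isClub {E} μ (_ , unbounded , closed) = (λ _ → tt) ,
    (λ β _ → let (γ , _ , β≤γ , μ≤γ) = join U β μ tt tt
                 (ξ , ξ∈E , γ≤ξ)     = unbounded γ tt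
             in ξ , (ξ∈E , ≤-trans μ≤γ γ≤ξ) , ≤-trans β≤γ γ≤ξ) ,
    λ α _ (x , (x∈E , μ≤x) , x<α) sup →
      closed α tt (x , x∈E , x<α) (isSup-mono (λ ((ξ∈E , _) , ξ<α) → ξ∈E , ξ<α) proj₂ sup) ,
      ≤-trans μ≤x (inj₁ x<α)

  otimes⇒guessingLadder : AtLeastTwo κ → Otimes κ → GuessingLadder κ
  otimes⇒guessingLadder {κ} 2≤κ ((_ , stationary) , C , C-club , guess) =
    let (C′ , C′-club , C′⊆C , τ-in) =
          extend-ladder S-in InaccessibleLimit C C-club noninaccessible⇒clubAvoiding
    in C′ , C′-club , λ E E-club →
      let A = S≥ κ ∩ E
          (δ , _ , δ-in , cfδ≥κ , not-bounded) = guess (cl A) (cl-A-club E-club)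
      in δ , cfδ≥κ , guess-on-extension C C′⊆C
        (τ-in (δ-in , cofinalityAtLeast⇒limit 2≤κ cfδ≥κ)) {B = nacc (cl A)}
        (λ (γ∈nacc , γ<δ) → let (cf , γ∈E) = nacc-cl {A} γ∈nacc in cf , γ∈E , γ<δ)
        not-bounded
    where
    cl-A-club : {E : Pred L ℓ} → IsClubIn U E → IsClubIn U (cl (S≥ κ ∩ E))
    cl-A-club {E} E-club = (λ _ → tt) ,
      (λ β _ →
        let (μ , _ , β≤μ , κ≤μ) = join U β κ tt tt
            -- The inaccessible γ is its own cofinality and is at least κ, so it lies in `S≥ κ`.
            (γ , (_ , (_ , _ , cf) , _) , γ∈E , μ≤γ) = stationary _ (tail-isClub μ E-club)
        in γ , ⊆-cl {S≥ κ ∩ E} ((γ , cf , ≤-trans κ≤μ μ≤γ) , γ∈E) , ≤-trans β≤μ μ≤γ) ,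
      λ α _ _ → cl-isSup {A = S≥ κ ∩ E}

claim21p3 :
    ∀ {ℓ : Level} → ExcludedMiddle (suc ℓ) →
    (Λ : WellOrder ℓ) →
    let open WellOrder Λ renaming (Carrier to L)
        open Ordinals Λ
    in
    IsRegular U → IsUncountable U →
    (κ : L) → IsCardinal (↓ κ) → AtLeastTwo κ →
    Otimes κ ⊎ Oplus κ →
    Σ[ c ∈ (L → L → ℕ) ]
      (∀ α β → c α β ≡ c β α)
      × (∀ (w : L → Pred L ℓ) →
          (∀ i j → i ≢ j → w i ⊥ w j) →
          (∀ i → Satisfiable (w i)) →
          (∀ i → CardinalityBelow (w i) κ) →
          ∀ (n : ℕ) →
          Σ[ Y ∈ Pred L ℓ ]
            HasCardinality Y U
            × (∀ i j → i ∈ Y → j ∈ Y → i < j →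
                (∀ α β → α ∈ w i → β ∈ w j → α < β)
                × (∀ α β → α ∈ w i → β ∈ w j → n <ℕ c α β)))
claim21p3 {ℓ} em Λ regular uncountable κ _ 2≤κ guess =
  colour , colour-sym , λ w disjoint _ small n → homogeneous w disjoint small n
  where
  open Classical {ℓ} (map′ lower lift em) Λ
  open Regular regular uncountable 2≤κ
  ladder : GuessingLadder κ
  ladder = [ otimes⇒guessingLadder 2≤κ , oplus⇒guessingLadder 2≤κ ]′ guess

  open Colouring (proj₁ ladder) (proj₁ (proj₂ ladder)) (proj₂ (proj₂ ladder))
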